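{- Let $p,q$ be integers, let $r,s$ be nonzero integers, let $m\ge 1$ be an integer and $l\in\{0,1,\dots,m-1\}$. Then the ordinary generating function $$GHml(p,q;r,s;m,l;x):=\sum_{n=0}^{\infty}H(p,q;r,s;mn+l)\,x^n$$ is given, as a formal power series in $x$, by $$GHml(p,q;r,s;m,l;x)=\frac{H(p,q;r,s;l)-\bigl(H(p,q;r,s;l)\,SUM(r,s;m)-H(p,q;r,s;m+l)\bigr)x}{1-SUM(r,s;m)\,x+(-s)^m\,x^2},$$ where $$SUM(r,s;m)=r^m\sum_{k=0}^{\lfloor m/2\rfloor}T(m,k)\,\left(\frac{s}{r^2}\right)^k .$$
   Context: For given $p,q,r,s$, the (Horadam) sequence $H(p,q;r,s;n)$, $n\ge 0$, is defined by $H(p,q;r,s;0)=p$, $H(p,q;r,s;1)=q$ and $H(p,q;r,s;n)=r\,H(p,q;r,s;n-1)+s\,H(p,q;r,s;n-2)$ for $n\ge 2$. $T(n,k)$ is the irregular triangle OEIS A034807: $T(0,0)=2$ and $T(n,k)=\frac{n\,(n-1-k)!}{k!\,(n-2k)!}$ for $n\ge 1$ and $0\le k\le\lfloor n/2\rfloor$. -}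

module Defs where

open import Algebra.Definitions.RawSemiring using (_^_)
open import Data.Fin.Base using (Fin; toℕ)
open import Data.Integer.Base as ℤ using (ℤ; +_)
import Data.Integer.Properties as ℤ
open import Data.List.Base using (List; []; _∷_)
open import Data.Nat.Base as ℕ using (ℕ; zero; suc; _∸_; ⌊_/2⌋; _!)
open import Data.Nat.Properties using (_!*_!≢0)
open import Data.Rational.Base
open import Data.Rational.Literals using (fromℤ)
open import Data.Rational.Properties
open import Data.Rational.Solver using (module +-*-Solver)
open import Relation.Binary.PropositionalEquality
open import Algebra.Properties.CommutativeMonoid.Sum +-0-commutativeMonoid using (sum; sum-syntax)

infixr 8 _^ℚ_
_^ℚ_ : ℚ → ℕ → ℚ
_^ℚ_ = _^_ +-*-rawSemiring

H : (p q r s : ℤ) → ℕ → ℤ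
H p q r s 0 = p
H p q r s 1 = q
H p q r s (suc (suc n)) = r ℤ.* H p q r s (suc n) ℤ.+ s ℤ.* H p q r s n

-- A034807.  The column index ranges over 0, …, ⌊n/2⌋ exactly, so the
-- truncated subtractions in the row n ≥ 1 never actually truncate.
T : (n : ℕ) → Fin (suc ⌊ n /2⌋) → ℚ
T 0         _ = + 2 / 1
T n@(suc _) i = (+ (n ℕ.* (n ∸ 1 ∸ k) !) / (k ! ℕ.* (n ∸ 2 ℕ.* k) !)) {{k !* (n ∸ 2 ℕ.* k) !≢0}}
  where
  k : ℕ
  k = toℕ i

SUM : (r s : ℤ) .{{_ : ℤ.NonZero r}} → ℕ → ℚ
SUM r s m = fromℤ r ^ℚ m * ∑[ k < suc ⌊ m /2⌋ ] (T m k * s/r² ^ℚ toℕ k)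
  where
  s/r² : ℚ
  s/r² = (fromℤ s ÷ fromℤ (r ℤ.* r)) {{ℤ.i*j≢0 r r}}

-- ℚ[[x]]: the series Σ F n xⁿ is represented by its coefficient sequence F.
FPS : Set
FPS = ℕ → ℚ

-- The polynomial with the given coefficients, constant term first.
poly : List ℚ → FPS
poly []       _       = 0ℚ
poly (c ∷ cs) zero    = c
poly (c ∷ cs) (suc n) = poly cs n

infixl 7 _·_ _÷ˢ_

_·_ : FPS → FPS → FPS
(F · G) n = ∑[ k < suc n ] (F (toℕ k) * G (n ∸ toℕ k))

-- Quotient by a series with invertible constant term, by long division:
-- with c = F₀ / G₀ one has  F / G = c + x · (((F − c G) / x) / G).
_÷ˢ_ : (F G : FPS) .{{_ : NonZero (G 0)}} → FPS
(F ÷ˢ G) zero    = F 0 ÷ G 0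
(F ÷ˢ G) (suc n) = ((λ i → F (suc i) - (F 0 ÷ G 0) * G (suc i)) ÷ˢ G) n

÷ˢ-· : (F G : FPS) .{{_ : NonZero (G 0)}} → (F ÷ˢ G) · G ≗ F
÷ˢ-· F G zero = begin
  F 0 * 1/ G 0 * G 0 + 0ℚ  ≡⟨ +-identityʳ _ ⟩
  F 0 * 1/ G 0 * G 0       ≡⟨ *-assoc (F 0) (1/ G 0) (G 0) ⟩
  F 0 * (1/ G 0 * G 0)     ≡⟨ cong (λ z → F 0 * z) (*-inverseˡ (G 0)) ⟩
  F 0 * 1ℚ                 ≡⟨ *-identityʳ (F 0) ⟩
  F 0                      ∎
  where open ≡-Reasoning
÷ˢ-· F G (suc n) = begin
  cG + ((F′ ÷ˢ G) · G) n   ≡⟨ cong (λ z → cG + z) (÷ˢ-· F′ G n) ⟩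
  cG + (F (suc n) - cG)    ≡⟨ solve 2 (λ a b → a :+ (b :- a) := b) refl cG (F (suc n)) ⟩
  F (suc n)                ∎
  where
  open ≡-Reasoning
  open +-*-Solver
  cG : ℚ
  cG = (F 0 ÷ G 0) * G (suc n)
  F′ : FPS
  F′ i = F (suc i) - (F 0 ÷ G 0) * G (suc i)

GHml : (p q r s : ℤ) (m l : ℕ) → FPS
GHml p q r s m l n = fromℤ (H p q r s (m ℕ.* n ℕ.+ l))

{-# OPTIONS --safe #-}
-- Write Vₘ for the Lucas sequence V₀ = 2, V₁ = r, Vₘ₊₂ = r Vₘ₊₁ + s Vₘ.  Every
-- solution W of the recurrence satisfies W₂ₘ₊ₙ + (-s)ᵐ Wₙ = Vₘ Wₘ₊ₙ, so each
-- subsequence with step m has characteristic polynomial 1 - Vₘ x + (-s)ᵐ x², and the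
-- product of its series with this polynomial has degree at most 1.  It remains to see
-- that SUM(r,s;m) = Vₘ: the triangle T obeys T(n+2,k+1) = T(n+1,k+1) + T(n,k), whence
-- A(n) = Σₖ T(n,k) uᵏ obeys A(n+2) = A(n+1) + u A(n), and for u = s/r² the scaled
-- sums rⁿ A(n) obey the recurrence of V.
module Submission where

open import Defs
open import Algebra.Bundles using (CommutativeRing)
open import Data.Fin.Base as Fin using (Fin; toℕ)
open import Data.Fin.Properties using (toℕ<n)
open import Data.Integer.Base as ℤ using (ℤ; +_)
import Data.Integer.Properties as ℤ
import Data.Integer.Solver as ℤ
open import Data.List.Base using ([]; _∷_)
open import Data.Nat.Base as ℕ using (ℕ; zero; suc; _∸_; ⌊_/2⌋; ⌈_/2⌉; _!; s≤s; z≤n)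
import Data.Nat.Properties as ℕ
import Data.Nat.Solver as ℕ
open import Data.Rational.Base
  using (ℚ; 0ℚ; 1ℚ; _+_; _*_; _-_; -_; _/_; _÷_; 1/_; NonZero; nonZero)
open import Data.Rational.Literals using (fromℤ)
open import Data.Rational.Properties
open import Data.Rational.Solver using (module +-*-Solver)
open import Data.Rational.Unnormalised.Base using (*≡*; mkℚᵘ)
import Data.Rational.Unnormalised.Properties as ℚᵘ
open import Function.Base using (_∘_)
open import Relation.Binary.PropositionalEquality
  using (_≡_; _≗_; refl; sym; trans; cong; cong₂; module ≡-Reasoning)
open import Algebra.Properties.Semiring.Sum
  (CommutativeRing.semiring +-*-commutativeRing)
  using (sum-syntax; sum-cong-≗; ∑-distrib-+; *-distribˡ-sum; sum-replicate-zero)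

-- Integers and fractions in ℚ

fromℤ-homo-+ : ∀ i j → fromℤ (i ℤ.+ j) ≡ fromℤ i + fromℤ j
fromℤ-homo-+ i j = toℚᵘ-injective (ℚᵘ.≃-trans
  (*≡* (ℤ.+-*-Solver.solve 2
    (λ a b → (a :+ b) :* con (+ 1) := (a :* con (+ 1) :+ b :* con (+ 1)) :* con (+ 1))
    refl i j))
  (ℚᵘ.≃-sym (toℚᵘ-homo-+ (fromℤ i) (fromℤ j))))
  where open ℤ.+-*-Solver

fromℤ-homo-* : ∀ i j → fromℤ (i ℤ.* j) ≡ fromℤ i * fromℤ j
fromℤ-homo-* i j = toℚᵘ-injective (ℚᵘ.≃-trans
  (*≡* refl) (ℚᵘ.≃-sym (toℚᵘ-homo-* (fromℤ i) (fromℤ j))))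

-- Taking the divisibility as the equation `l ℕ.* d ≡ a` lets a quotient of factorials be recognised
-- as an integer directly from an identity between products.
[l*d]/d≡l : ∀ {a} l d .{{_ : ℕ.NonZero d}} → l ℕ.* d ≡ a → + a / d ≡ fromℤ (+ l)
[l*d]/d≡l {a} l (suc d) ld≡a = trans
  (fromℚᵘ-cong {mkℚᵘ (+ a) d} {mkℚᵘ (+ l) 0} (*≡* (begin
    + a ℤ.* + 1          ≡⟨ ℤ.*-identityʳ (+ a) ⟩
    + a                  ≡⟨ cong +_ ld≡a ⟨
    + (l ℕ.* suc d)      ≡⟨ ℤ.pos-* l (suc d) ⟩
    + l ℤ.* + suc d      ∎)))
  (fromℚᵘ-toℚᵘ (fromℤ (+ l)))
  where open ≡-Reasoning

p÷q*q≡p : ∀ p q .{{_ : NonZero q}} → (p ÷ q) * q ≡ p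
p÷q*q≡p p q = begin
  p * 1/ q * q    ≡⟨ *-assoc p (1/ q) q ⟩
  p * (1/ q * q)  ≡⟨ cong (p *_) (*-inverseˡ q) ⟩
  p * 1ℚ          ≡⟨ *-identityʳ p ⟩
  p               ∎
  where open ≡-Reasoning

p*q÷q≡p : ∀ p q .{{_ : NonZero q}} → p * q ÷ q ≡ p
p*q÷q≡p p q = begin
  p * q * 1/ q    ≡⟨ *-assoc p q (1/ q) ⟩
  p * (q * 1/ q)  ≡⟨ cong (p *_) (*-inverseʳ q) ⟩
  p * 1ℚ          ≡⟨ *-identityʳ p ⟩
  p               ∎
  where open ≡-Reasoning

-- Formal power series

-- Long division is forced: the constant coefficient of the product determines `F 0`, and once `F 0`
-- times `G` is subtracted, the tail of `F` satisfies the same kind of equation with the next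
-- remainder. A claim about a quotient thus reduces to computing one product.
÷ˢ-unique : ∀ F N G .{{_ : NonZero (G 0)}} → F · G ≗ N → F ≗ N ÷ˢ G
÷ˢ-unique F N G FG≗N zero = begin
  F 0              ≡⟨ p*q÷q≡p (F 0) (G 0) ⟨
  F 0 * G 0 ÷ G 0  ≡⟨ cong (_÷ G 0) (trans (sym (+-identityʳ (F 0 * G 0))) (FG≗N 0)) ⟩
  N 0 ÷ G 0        ∎
  where open ≡-Reasoning
÷ˢ-unique F N G FG≗N (suc n) = ÷ˢ-unique (F ∘ suc) _ G tail n
  where
  open ≡-Reasoning
  tail : ∀ i → ((F ∘ suc) · G) i ≡ N (suc i) - (N 0 ÷ G 0) * G (suc i)
  tail i = begin
    ((F ∘ suc) · G) i
      ≡⟨ solve 2 (λ a b → b := (a :+ b) :- a) refl (F 0 * G (suc i)) _ ⟩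
    (F · G) (suc i) - F 0 * G (suc i)
      ≡⟨ cong₂ (λ x y → x - y * G (suc i)) (FG≗N (suc i)) (÷ˢ-unique F N G FG≗N 0) ⟩
    N (suc i) - (N 0 ÷ G 0) * G (suc i) ∎
    where open +-*-Solver

-- Only the last three terms of the convolution meet a nonzero coefficient. The induction discards
-- the first term, which from degree 3 on is paired with a 0, and shifts `F`.
·-quadratic : ∀ F a b c n →
  (F · poly (a ∷ b ∷ c ∷ [])) (suc (suc n)) ≡ F (suc (suc n)) * a + F (suc n) * b + F n * c
·-quadratic F a b c zero =
  solve 6 (λ x y z a b c → x :* c :+ (y :* b :+ (z :* a :+ con 0ℚ)) := z :* a :+ y :* b :+ x :* c)
    refl (F 0) (F 1) (F 2) a b c
  where open +-*-Solver
·-quadratic F a b c (suc n) = begin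
  F 0 * 0ℚ + ((F ∘ suc) · poly (a ∷ b ∷ c ∷ [])) (suc (suc n))
    ≡⟨ cong (_+ ((F ∘ suc) · poly (a ∷ b ∷ c ∷ [])) (suc (suc n))) (*-zeroʳ (F 0)) ⟩
  0ℚ + ((F ∘ suc) · poly (a ∷ b ∷ c ∷ [])) (suc (suc n))
    ≡⟨ +-identityˡ _ ⟩
  ((F ∘ suc) · poly (a ∷ b ∷ c ∷ [])) (suc (suc n))
    ≡⟨ ·-quadratic (F ∘ suc) a b c n ⟩
  F (suc (suc (suc n))) * a + F (suc (suc n)) * b + F (suc n) * c ∎
  where open ≡-Reasoning

-- Second-order linear recurrences

Recurrent : ℚ → ℚ → (ℕ → ℚ) → Set
Recurrent ρ σ W = ∀ n → W (suc (suc n)) ≡ ρ * W (suc n) + σ * W n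

H-recurrent : ∀ p q r s → Recurrent (fromℤ r) (fromℤ s) (fromℤ ∘ H p q r s)
H-recurrent p q r s n = trans
  (fromℤ-homo-+ (r ℤ.* H p q r s (suc n)) (s ℤ.* H p q r s n))
  (cong₂ _+_ (fromℤ-homo-* r (H p q r s (suc n))) (fromℤ-homo-* s (H p q r s n)))

V : ℚ → ℚ → ℕ → ℚ
V ρ σ 0             = fromℤ (+ 2)
V ρ σ 1             = ρ
V ρ σ (suc (suc n)) = ρ * V ρ σ (suc n) + σ * V ρ σ n

-- Two-step induction on `m` with `n` free. The instances at `suc m` and `m` are taken with offsets
-- `suc n` and `suc (suc n)`, so that both right-hand sides carry the same value of `W` and the
-- recurrence of `V` can be factored out.
V-step : ∀ {ρ σ W} → Recurrent ρ σ W → ∀ m n →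
  W (m ℕ.+ (m ℕ.+ n)) + (- σ) ^ℚ m * W n ≡ V ρ σ m * W (m ℕ.+ n)
V-step {W = W} rec zero n =
  solve 1 (λ w → w :+ con 1ℚ :* w := con (fromℤ (+ 2)) :* w) refl (W n)
  where open +-*-Solver
V-step {ρ} {σ} {W} rec (suc zero) n = begin
  W (suc (suc n)) + (- σ * 1ℚ) * W n
    ≡⟨ cong (_+ (- σ * 1ℚ) * W n) (rec n) ⟩
  ρ * W (suc n) + σ * W n + (- σ * 1ℚ) * W n
    ≡⟨ solve 3 (λ a σ w → a :+ σ :* w :+ (:- σ :* con 1ℚ) :* w := a) refl (ρ * W (suc n)) σ (W n) ⟩
  ρ * W (suc n) ∎
  where
  open ≡-Reasoning
  open +-*-Solver using (solve; con; _:+_; _:*_; :-_; _:-_; _:=_)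
V-step {ρ} {σ} {W} rec (suc (suc m)) n = begin
  W (suc (suc m) ℕ.+ (suc (suc m) ℕ.+ n)) + (- σ * (- σ * P)) * W n
    ≡⟨ cong (λ w → w + (- σ * (- σ * P)) * W n) W-top ⟩
  (ρ * x + σ * y) + (- σ * (- σ * P)) * W n
    -- The two added terms in `w₁` cancel, since the sign powers for `m` and `suc m` differ by the
    -- factor `- σ`.
    ≡⟨ solve 7 (λ ρ σ x y P w₀ w₁ →
         (ρ :* x :+ σ :* y) :+ (:- σ :* (:- σ :* P)) :* w₀ :=
         ρ :* (x :+ (:- σ :* P) :* w₁) :+ σ :* (y :+ P :* (ρ :* w₁ :+ σ :* w₀)))
         refl ρ σ x y P (W n) (W (suc n)) ⟩
  ρ * (x + (- σ * P) * W (suc n)) + σ * (y + P * (ρ * W (suc n) + σ * W n))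
    ≡⟨ cong₂ (λ a b → ρ * a + σ * b)
         (V-step rec (suc m) (suc n))
         (trans (cong (λ w → y + P * w) (sym (rec n))) (V-step rec m (suc (suc n)))) ⟩
  ρ * (V ρ σ (suc m) * W (suc m ℕ.+ suc n)) + σ * (V ρ σ m * W (m ℕ.+ suc (suc n)))
    ≡⟨ cong₂ (λ i j → ρ * (V ρ σ (suc m) * W i) + σ * (V ρ σ m * W j))
         (cong suc (ℕ.+-suc m n)) m+2+n ⟩
  ρ * (V ρ σ (suc m) * w) + σ * (V ρ σ m * w)
    ≡⟨ solve 5 (λ ρ σ a b w → ρ :* (a :* w) :+ σ :* (b :* w) := (ρ :* a :+ σ :* b) :* w)
         refl ρ σ (V ρ σ (suc m)) (V ρ σ m) w ⟩
  V ρ σ (suc (suc m)) * w ∎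
  where
  open ≡-Reasoning
  open +-*-Solver using (solve; con; _:+_; _:*_; :-_; _:-_; _:=_)
  P w x y : ℚ
  P = (- σ) ^ℚ m
  w = W (suc (suc m) ℕ.+ n)
  x = W (suc m ℕ.+ (suc m ℕ.+ suc n))
  y = W (m ℕ.+ (m ℕ.+ suc (suc n)))
  m+2+n : m ℕ.+ suc (suc n) ≡ suc (suc (m ℕ.+ n))
  m+2+n = trans (ℕ.+-suc m (suc n)) (cong suc (ℕ.+-suc m n))
  W-top : W (suc (suc m) ℕ.+ (suc (suc m) ℕ.+ n)) ≡ ρ * x + σ * y
  W-top = trans (rec (m ℕ.+ (suc (suc m) ℕ.+ n)))
    (cong₂ (λ i j → ρ * W (suc (m ℕ.+ i)) + σ * W (m ℕ.+ j))
      (cong suc (sym (ℕ.+-suc m n))) (sym m+2+n))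

-- The Lucas triangle

-- T without its row bounds: the entries with 2k > n are 0.
lucas : ℕ → ℕ → ℕ
lucas zero          zero    = 2
lucas zero          (suc k) = 0
lucas (suc n)       zero    = 1
lucas (suc zero)    (suc k) = 0
lucas (suc (suc n)) (suc k) = lucas (suc n) (suc k) ℕ.+ lucas n k

lucas-vanishes : ∀ {n k} → n ℕ.< k ℕ.* 2 → lucas n k ≡ 0
lucas-vanishes {zero}        {suc k} _ = refl
lucas-vanishes {suc zero}    {suc k} _ = refl
lucas-vanishes {suc (suc n)} {suc k} (s≤s (s≤s n<2k)) =
  cong₂ ℕ._+_ (lucas-vanishes {suc n} (s≤s (ℕ.m≤n⇒m≤1+n n<2k))) (lucas-vanishes n<2k)

-- Of the two summands the first lies just outside its row, so the 2 at the apex is carried down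
-- unchanged.
lucas-diagonal : ∀ k → lucas (k ℕ.* 2) k ≡ 2
lucas-diagonal zero    = refl
lucas-diagonal (suc k) =
  cong₂ ℕ._+_ (lucas-vanishes {suc (k ℕ.* 2)} {suc k} ℕ.≤-refl) (lucas-diagonal k)

-- The closed form with denominators cleared and with row `k ℕ.* 2 ℕ.+ j`, so that no subtraction
-- occurs. The hypothesis defines `e` as `k ℕ.+ j` minus 1 and excludes only the apex. The cases are
-- the left edge, the diagonal and the interior.
lucas-! : ∀ k j {e} → suc e ≡ k ℕ.+ j →
  lucas (k ℕ.* 2 ℕ.+ j) k ℕ.* (k ! ℕ.* j !) ≡ (k ℕ.* 2 ℕ.+ j) ℕ.* e !
lucas-! zero (suc j) refl = trans (ℕ.*-identityˡ _) (ℕ.*-identityˡ _)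
lucas-! (suc k) zero refl
  rewrite ℕ.+-identityʳ k | ℕ.+-identityʳ (k ℕ.* 2) | lucas-diagonal (suc k) =
  solve 2 (λ k x → con 2 :* ((con 1 :+ k) :* x :* con 1) := (con 2 :+ k :* con 2) :* x)
    refl k (k !)
  where open ℕ.+-*-Solver
lucas-! (suc k) (suc j) refl = begin
  (lucas (suc (k ℕ.* 2 ℕ.+ suc j)) (suc k) ℕ.+ y) ℕ.* (suc k ! ℕ.* suc j !)
    ≡⟨ cong (λ i → (lucas (suc i) (suc k) ℕ.+ y) ℕ.* (suc k ! ℕ.* suc j !)) (ℕ.+-suc (k ℕ.* 2) j) ⟩
  (x ℕ.+ y) ℕ.* (suc k ! ℕ.* suc j !)
    -- Each summand receives its own pair of factorials; the surplus factor is `suc j` for `x` and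
    -- `suc k` for `y`.
    ≡⟨ solve 6 (λ x y k j k! j! →
         (x :+ y) :* (((con 1 :+ k) :* k!) :* ((con 1 :+ j) :* j!)) :=
         (con 1 :+ j) :* (x :* (((con 1 :+ k) :* k!) :* j!)) :+
         (con 1 :+ k) :* (y :* (k! :* ((con 1 :+ j) :* j!))))
         refl x y k j (k !) (j !) ⟩
  suc j ℕ.* (x ℕ.* (suc k ! ℕ.* j !)) ℕ.+ suc k ℕ.* (y ℕ.* (k ! ℕ.* suc j !))
    ≡⟨ cong₂ (λ a b → suc j ℕ.* a ℕ.+ suc k ℕ.* b)
         (lucas-! (suc k) j refl) (lucas-! k (suc j) (sym (ℕ.+-suc k j))) ⟩
  suc j ℕ.* ((suc k ℕ.* 2 ℕ.+ j) ℕ.* E) ℕ.+ suc k ℕ.* ((k ℕ.* 2 ℕ.+ suc j) ℕ.* E)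
    -- The cofactors of `E` add up to a product: (j+1)(2k+2+j) + (k+1)(2k+1+j) = (2k+3+j)(k+j+1).
    ≡⟨ solve 3 (λ k j E →
         (con 1 :+ j) :* ((con 2 :+ k :* con 2 :+ j) :* E) :+
         (con 1 :+ k) :* ((k :* con 2 :+ (con 1 :+ j)) :* E) :=
         (con 2 :+ k :* con 2 :+ (con 1 :+ j)) :* ((con 1 :+ (k :+ j)) :* E))
         refl k j E ⟩
  (suc k ℕ.* 2 ℕ.+ suc j) ℕ.* (suc (k ℕ.+ j)) !
    ≡⟨ cong (λ i → (suc k ℕ.* 2 ℕ.+ suc j) ℕ.* i !) (ℕ.+-suc k j) ⟨
  (suc k ℕ.* 2 ℕ.+ suc j) ℕ.* (k ℕ.+ suc j) ! ∎
  where
  open ≡-Reasoning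
  open ℕ.+-*-Solver
  E x y : ℕ
  E = (k ℕ.+ j) !
  x = lucas (suc k ℕ.* 2 ℕ.+ j) (suc k)
  y = lucas (k ℕ.* 2 ℕ.+ suc j) k

T≡lucas : ∀ n (i : Fin (suc ⌊ n /2⌋)) → T n i ≡ fromℤ (+ lucas n (toℕ i))
T≡lucas zero      Fin.zero = refl
T≡lucas n@(suc d) i        = [l*d]/d≡l (lucas n k) (k ! ℕ.* (n ∸ 2 ℕ.* k) !)
  {{k ℕ.!* (n ∸ 2 ℕ.* k) !≢0}}
  (trans (cong (λ a → lucas a k ℕ.* (k ! ℕ.* j !)) (sym 2k+j≡n))
    (trans (lucas-! k j 1+e≡k+j) (cong (ℕ._* (d ∸ k) !) 2k+j≡n)))
  where
  k j : ℕ
  k = toℕ i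
  j = n ∸ 2 ℕ.* k
  k≤n/2 : k ℕ.≤ ⌊ n /2⌋
  k≤n/2 = ℕ.≤-pred (toℕ<n i)
  2k≤n : 2 ℕ.* k ℕ.≤ n
  2k≤n = begin
    2 ℕ.* k            ≡⟨ cong (λ i → k ℕ.+ i) (ℕ.+-identityʳ k) ⟩
    k ℕ.+ k            ≤⟨ ℕ.+-mono-≤ k≤n/2 (ℕ.≤-trans k≤n/2 (ℕ.⌊n/2⌋≤⌈n/2⌉ n)) ⟩
    ⌊ n /2⌋ ℕ.+ ⌈ n /2⌉  ≡⟨ ℕ.⌊n/2⌋+⌈n/2⌉≡n n ⟩
    n                  ∎
    where open ℕ.≤-Reasoning
  2k+j≡n : k ℕ.* 2 ℕ.+ j ≡ n
  2k+j≡n = trans (cong (ℕ._+ j) (ℕ.*-comm k 2)) (ℕ.m+[n∸m]≡n 2k≤n)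
  -- Since `d` is n - 1, the factorial in the numerator of `T` is that of k + j - 1.
  1+e≡k+j : suc (d ∸ k) ≡ k ℕ.+ j
  1+e≡k+j = begin
    suc (d ∸ k)                ≡⟨ ℕ.+-∸-assoc 1 k≤d ⟨
    n ∸ k                      ≡⟨ cong (_∸ k) 2k+j≡n ⟨
    k ℕ.* 2 ℕ.+ j ∸ k          ≡⟨ cong (_∸ k) (solve 2 (λ k j → k :* con 2 :+ j := k :+ (k :+ j)) refl k j) ⟩
    k ℕ.+ (k ℕ.+ j) ∸ k        ≡⟨ ℕ.m+n∸m≡n k (k ℕ.+ j) ⟩
    k ℕ.+ j                    ∎
    where
    open ≡-Reasoning
    open ℕ.+-*-Solver
    k≤d : k ℕ.≤ d
    k≤d = ℕ.≤-trans k≤n/2 (ℕ.≤-pred (ℕ.⌊n/2⌋<n d))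

-- Weighted row sums of the Lucas triangle

lucasSum : ℚ → ℕ → ℕ → ℚ
lucasSum u n N = ∑[ k < N ] (fromℤ (+ lucas n (toℕ k)) * u ^ℚ toℕ k)

-- Column 0 is 1 in both rows `suc n` and `suc (suc n)`. Every later column also draws on the
-- preceding column of row `n`, which accounts for the factor `u` and for the bound `N` there.
lucasSum-rec : ∀ u n N →
  lucasSum u (suc (suc n)) (suc N) ≡ lucasSum u (suc n) (suc N) + u * lucasSum u n N
lucasSum-rec u n N = begin
  1ℚ * 1ℚ + ∑[ k < N ] (fromℤ (+ (b k ℕ.+ a k)) * (u * u ^ℚ toℕ k))
    ≡⟨ cong (λ z → 1ℚ * 1ℚ + z) (sum-cong-≗ λ k → trans
         (cong (_* (u * u ^ℚ toℕ k)) (fromℤ-homo-+ (+ b k) (+ a k)))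
         (solve 4 (λ b a u p → (b :+ a) :* (u :* p) := b :* (u :* p) :+ u :* (a :* p))
           refl (fromℤ (+ b k)) (fromℤ (+ a k)) u (u ^ℚ toℕ k))) ⟩
  1ℚ * 1ℚ + ∑[ k < N ] (f k + u * g k)
    ≡⟨ cong (λ z → 1ℚ * 1ℚ + z) (∑-distrib-+ f (λ k → u * g k)) ⟩
  1ℚ * 1ℚ + (∑[ k < N ] f k + ∑[ k < N ] (u * g k))
    ≡⟨ cong (λ z → 1ℚ * 1ℚ + (∑[ k < N ] f k + z)) (*-distribˡ-sum u g) ⟨
  1ℚ * 1ℚ + (∑[ k < N ] f k + u * ∑[ k < N ] g k)
    ≡⟨ +-assoc (1ℚ * 1ℚ) (∑[ k < N ] f k) (u * ∑[ k < N ] g k) ⟨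
  1ℚ * 1ℚ + ∑[ k < N ] f k + u * ∑[ k < N ] g k ∎
  where
  open ≡-Reasoning
  open +-*-Solver using (solve; con; _:+_; _:*_; :-_; _:-_; _:=_)
  a b : Fin N → ℕ
  a k = lucas n (toℕ k)
  b k = lucas (suc n) (suc (toℕ k))
  f g : Fin N → ℚ
  f k = fromℤ (+ b k) * (u * u ^ℚ toℕ k)
  g k = fromℤ (+ a k) * u ^ℚ toℕ k

∑[0*f]≡0 : ∀ {N} (f : Fin N → ℚ) → ∑[ k < N ] (0ℚ * f k) ≡ 0ℚ
∑[0*f]≡0 {N} f = trans (sum-cong-≗ (*-zeroˡ ∘ f)) (sum-replicate-zero N)

-- The upper bound N is kept arbitrary because ⌊n/2⌋ and ⌊(n+1)/2⌋ advance unevenly.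
lucasSum≡V : ∀ {ρ σ} u → u * (ρ * ρ) ≡ σ → ∀ n {N} → ⌊ n /2⌋ ℕ.< N →
  ρ ^ℚ n * lucasSum u n N ≡ V ρ σ n
lucasSum≡V u _ zero {suc N} _ =
  cong (λ z → 1ℚ * (fromℤ (+ 2) * 1ℚ + z)) (∑[0*f]≡0 {N} (λ k → u * u ^ℚ toℕ k))
lucasSum≡V {ρ} u _ (suc zero) {suc N} _ = trans
  (cong (λ z → ρ * 1ℚ * (1ℚ * 1ℚ + z)) (∑[0*f]≡0 {N} (λ k → u * u ^ℚ toℕ k)))
  (trans (*-identityʳ (ρ * 1ℚ)) (*-identityʳ ρ))
lucasSum≡V {ρ} {σ} u uρ²≡σ (suc (suc n)) {suc N} (s≤s n/2<N) = begin
  ρ * (ρ * P) * lucasSum u (suc (suc n)) (suc N)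
    ≡⟨ cong ((ρ * (ρ * P)) *_) (lucasSum-rec u n N) ⟩
  ρ * (ρ * P) * (B + u * A)
    -- One factor `ρ` completes the power for row `suc n`; for row `n` both are spent on turning `u`
    -- into `σ`.
    ≡⟨ solve 5 (λ ρ P B u A → ρ :* (ρ :* P) :* (B :+ u :* A) :=
         ρ :* ((ρ :* P) :* B) :+ (u :* (ρ :* ρ)) :* (P :* A)) refl ρ P B u A ⟩
  ρ * ((ρ * P) * B) + (u * (ρ * ρ)) * (P * A)
    ≡⟨ cong₂ _+_
         (cong (ρ *_) (lucasSum≡V u uρ²≡σ (suc n) (s≤s 1+n/2≤N)))
         (cong₂ _*_ uρ²≡σ (lucasSum≡V u uρ²≡σ n n/2<N)) ⟩
  ρ * V ρ σ (suc n) + σ * V ρ σ n ∎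
  where
  open ≡-Reasoning
  open +-*-Solver using (solve; con; _:+_; _:*_; :-_; _:-_; _:=_)
  P A B : ℚ
  P = ρ ^ℚ n
  A = lucasSum u n N
  B = lucasSum u (suc n) (suc N)
  1+n/2≤N : ⌊ suc n /2⌋ ℕ.≤ N
  1+n/2≤N = ℕ.≤-trans (ℕ.⌊n/2⌋-mono (ℕ.n≤1+n (suc n))) n/2<N

SUM≡V : ∀ r s .{{_ : ℤ.NonZero r}} m → SUM r s m ≡ V (fromℤ r) (fromℤ s) m
SUM≡V r s m = trans
  (cong ((fromℤ r ^ℚ m) *_) (sum-cong-≗ λ k → cong (_* u ^ℚ toℕ k) (T≡lucas m k)))
  (lucasSum≡V u ur²≡s m ℕ.≤-refl)
  where
  u : ℚ
  u = (fromℤ s ÷ fromℤ (r ℤ.* r)) {{ℤ.i*j≢0 r r}}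
  ur²≡s : u * (fromℤ r * fromℤ r) ≡ fromℤ s
  ur²≡s = trans (cong (u *_) (sym (fromℤ-homo-* r r)))
    (p÷q*q≡p (fromℤ s) (fromℤ (r ℤ.* r)) {{ℤ.i*j≢0 r r}})

-- The generating function

mainTheorem3 : (p q r s : ℤ) .{{_ : ℤ.NonZero r}} .{{_ : ℤ.NonZero s}}
    (m l : ℕ) → 1 ℕ.≤ m → l ℕ.< m →
    GHml p q r s m l ≗
    poly (fromℤ (H p q r s l)
    ∷ - (fromℤ (H p q r s l) * SUM r s m - fromℤ (H p q r s (m ℕ.+ l)))
    ∷ [])
    ÷ˢ
    poly (1ℚ ∷ - SUM r s m ∷ (- fromℤ s) ^ℚ m ∷ [])
mainTheorem3 p q r s m l _ _ = ÷ˢ-unique F _ (poly (1ℚ ∷ - S ∷ P ∷ [])) product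
  where
  open ≡-Reasoning
  open +-*-Solver using (solve; con; _:+_; _:*_; :-_; _:-_; _:=_)
  F W : ℕ → ℚ
  F = GHml p q r s m l
  W = fromℤ ∘ H p q r s
  S P : ℚ
  S = SUM r s m
  P = (- fromℤ s) ^ℚ m
  F₀ : F 0 ≡ W l
  F₀ = cong (λ i → W (i ℕ.+ l)) (ℕ.*-zeroʳ m)
  F-suc : ∀ n → F (suc n) ≡ W (m ℕ.+ (m ℕ.* n ℕ.+ l))
  F-suc n = cong W (trans (cong (ℕ._+ l) (ℕ.*-suc m n)) (ℕ.+-assoc m (m ℕ.* n) l))
  F-suc² : ∀ n → F (suc (suc n)) ≡ W (m ℕ.+ (m ℕ.+ (m ℕ.* n ℕ.+ l)))
  F-suc² n = trans (F-suc (suc n)) (cong (λ i → W (m ℕ.+ i))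
    (trans (cong (ℕ._+ l) (ℕ.*-suc m n)) (ℕ.+-assoc m (m ℕ.* n) l)))
  F₁ : F 1 ≡ W (m ℕ.+ l)
  F₁ = trans (F-suc 0) (cong (λ i → W (m ℕ.+ (i ℕ.+ l))) (ℕ.*-zeroʳ m))
  F-rec : ∀ n → F (suc (suc n)) + P * F n ≡ S * F (suc n)
  F-rec n = begin
    F (suc (suc n)) + P * F n
      ≡⟨ cong (_+ P * F n) (F-suc² n) ⟩
    W (m ℕ.+ (m ℕ.+ (m ℕ.* n ℕ.+ l))) + P * F n
      -- With offset `m ℕ.* n ℕ.+ l`, the three values of `W` are consecutive terms of the
      -- subsequence with step `m`.
      ≡⟨ V-step {W = W} (H-recurrent p q r s) m (m ℕ.* n ℕ.+ l) ⟩
    V (fromℤ r) (fromℤ s) m * W (m ℕ.+ (m ℕ.* n ℕ.+ l))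
      ≡⟨ cong₂ _*_ (SUM≡V r s m) (F-suc n) ⟨
    S * F (suc n) ∎
  product : F · poly (1ℚ ∷ - S ∷ P ∷ []) ≗ poly (W l ∷ - (W l * S - W (m ℕ.+ l)) ∷ [])
  product 0 = trans (+-identityʳ _) (trans (*-identityʳ (F 0)) F₀)
  product 1 = begin
    F 0 * - S + (F 1 * 1ℚ + 0ℚ)
      ≡⟨ cong₂ (λ a b → a * - S + (b * 1ℚ + 0ℚ)) F₀ F₁ ⟩
    W l * - S + (W (m ℕ.+ l) * 1ℚ + 0ℚ)
      ≡⟨ solve 3 (λ a b S → a :* :- S :+ (b :* con 1ℚ :+ con 0ℚ) := :- (a :* S :- b))
           refl (W l) (W (m ℕ.+ l)) S ⟩
    - (W l * S - W (m ℕ.+ l)) ∎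
  -- From degree 2 on, the coefficient is exactly the defect in `F-rec`, hence 0.
  product (suc (suc n)) = begin
    (F · poly (1ℚ ∷ - S ∷ P ∷ [])) (suc (suc n))
      ≡⟨ ·-quadratic F 1ℚ (- S) P n ⟩
    F (suc (suc n)) * 1ℚ + F (suc n) * - S + F n * P
      ≡⟨ solve 5 (λ x y z S P → z :* con 1ℚ :+ y :* :- S :+ x :* P := (z :+ P :* x) :- S :* y)
           refl (F n) (F (suc n)) (F (suc (suc n))) S P ⟩
    F (suc (suc n)) + P * F n - S * F (suc n)
      ≡⟨ cong (_- S * F (suc n)) (F-rec n) ⟩
    S * F (suc n) - S * F (suc n)
      ≡⟨ +-inverseʳ (S * F (suc n)) ⟩
    0ℚ ∎
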